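{- For every natural number $n\ge 1$ and every $\boldsymbol{\Delta}^1_n$-measurable function $f:\mathcal{N}\to\mathcal{N}$ there is some $\alpha\in\mathcal{N}$ such that the set \[ \mathrm{G}^{\mathcal{N}}_n(\alpha)\,\triangle\,\mathrm{U}^{\mathcal{N}}(f(\alpha)) \] is non-meager in $\mathcal{N}$.
   Context: Notation. $\omega=\{0,1,2,\dots\}$; $\mathcal{N}=\omega^\omega$ is the Baire space with the product topology. $\triangle$ denotes symmetric difference. For $P\subseteq X\times Y$ and $x\in X$, the section $\{y\in Y : (x,y)\in P\}$ is denoted $P(x)$; we write $P(x,y)$ for $(x,y)\in P$. $\boldsymbol{\Delta}^1_n=\boldsymbol{\Sigma}^1_n\cap\boldsymbol{\Pi}^1_n$ are the usual (boldface) projective classes. A function $f:\mathcal{N}\to\mathcal{N}$ is $\boldsymbol{\Delta}^1_n$-measurable if $f^{ -1}[V]$ is $\boldsymbol{\Delta}^1_n$ for every open $V\subseteq\mathcal{N}$. Coding of finite sequences. For $n\ge 1$, $\langle u_0,\dots,u_{n-1}\rangle=p_0^{u_0+1}\cdots p_{n-1}^{u_{n-1}+1}$, where $p_0<p_1<\dots$ are the primes; $\langle\emptyset\rangle=1$. If $s=\langle u_0,\dots,u_{n-1}\rangle$ and $i<n$, then $(s)_i:=u_i$; if $i\ge n$ or $s$ is not in the image of $\langle\cdot\rangle$, then $(s)_i:=0$. Put $q_k=(k)_0/((k)_1+1)$, an enumeration of the non-negative rationals. Basic open sets. For every Polish space $\mathcal{X}$ (including products) a compatible metric $d_{\mathcal{X}}$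 and a dense sequence $(r^{\mathcal{X}}_i)_{i\in\omega}$ are fixed (a recursive presentation when the space is recursively presented), and $N(\mathcal{X},s)$ is the open $d_{\mathcal{X}}$-ball with center $r^{\mathcal{X}}_{(s)_0}$ and radius $q_{(s)_1}$ (the empty set if the radius is $0$). For $\mathcal{N}$ the choice is: $d_{\mathcal{N}}(\alpha,\beta)=(n+1)^{ -1}$ with $n$ least such that $\alpha(n)\ne\beta(n)$ if $\alpha\ne\beta$, $d_{\mathcal{N}}(\alpha,\alpha)=0$, and $r^{\mathcal{N}}_s(i)=(s)_i$. Universal sets. For every Polish space $\mathcal{X}$ define $\mathrm{U}^{\mathcal{X}},\mathrm{F}^{\mathcal{X}},\mathrm{G}^{\mathcal{X}}_n\subseteq\mathcal{N}\times\mathcal{X}$ ($n\ge 1$) by $\mathrm{U}^{\mathcal{X}}(\alpha,x)\iff(\exists n\in\omega)[x\in N(\mathcal{X},\alpha(n))]$; $\mathrm{F}^{\mathcal{X}}(\alpha,x)\iff\neg\,\mathrm{U}^{\mathcal{X}}(\alpha,x)$; $\mathrm{G}^{\mathcal{X}}_1(\alpha,x)\iff(\exists\gamma\in\mathcal{N})\,\mathrm{F}^{\mathcal{X}\times\mathcal{N}}(\alpha,x,\gamma)$; $\mathrm{G}^{\mathcal{X}}_{n+1}(\alpha,x)\iff(\exists\gamma\in\mathcal{N})\,\neg\,\mathrm{G}^{\mathcal{X}\times\mathcal{N}}_n(\alpha,x,\gamma)$. Thus $\mathrm{U}^{\mathcal{X}}$ is universal for the open subsets of $\mathcal{X}$ and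 $\mathrm{G}^{\mathcal{X}}_n$ is universal for the $\boldsymbol{\Sigma}^1_n$ subsets of $\mathcal{X}$. -}

module Defs where

open import Data.Integer.Base using (+_)
open import Data.List.Base using (List; []; _∷_)
open import Data.Nat.Base
open import Data.Nat.Divisibility using (_∣_; _∣?_; divides; ∣⇒≤; ∣-trans; ∣1⇒≡1; ∣m+n∣m⇒∣n; m∣m*n; m≤n⇒m!∣n!)
open import Data.Nat.Induction using (<-wellFounded)
open import Data.Nat.Primality using (Prime; prime?; prime[2]; ¬prime[1]; prime⇒nonZero; prime⇒nonTrivial)
open import Data.Nat.Primality.Factorisation using (factorise)
open import Data.Nat.Properties
open import Data.Product.Base using (Σ-syntax; ∃; ∃-syntax; _×_; _,_; proj₁; proj₂)
open import Data.Rational.Base as ℚ using (ℚ; 0ℚ)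
open import Data.Sum.Base using (_⊎_; inj₁; inj₂)
open import Function.Bundles using (_⇔_)
open import Induction.WellFounded using (Acc; acc)
open import Level using (0ℓ) renaming (suc to lsuc)
open import Relation.Binary.PropositionalEquality
open import Relation.Nullary using (¬_; Dec; yes; no; contradiction)
open import Relation.Nullary.Decidable using (map′)
open import Relation.Unary using (Pred; Empty; ∁; _∈_; _⊆_; _≐_; _∖_; _∪_; ⋃; _⊢_)
import Data.List.Relation.Unary.All as All

NextPrime : ℕ → ℕ → Set
NextPrime m p = m < p × Prime p × (∀ k → m < k → k < p → ¬ Prime k)

private
  primeFactor : ∀ n → 1 < n → ∃[ p ] Prime p × p ∣ n
  primeFactor n@(suc _) 1<n with factorise n
  ... | record { factors = []    ; isFactorisation = eq } = contradiction (sym eq) (<⇒≢ 1<n)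
  ... | record { factors = p ∷ ps ; isFactorisation = eq ; factorsPrime = pr All.∷ _ } =
    p , pr , subst (p ∣_) (sym eq) (m∣m*n _)

  n∣n! : ∀ n → .{{NonZero n}} → n ∣ n !
  n∣n! (suc n) = m∣m*n (n !)

  euclid : ∀ m → ∃[ p ] m < p × p ≤ m ! + 1 × Prime p
  euclid m with primeFactor (m ! + 1) (subst (1 <_) (+-comm 1 (m !)) (s≤s (1≤n! m)))
  ... | p , pr , p∣ with m <? p
  ...   | yes m<p = p , m<p , ∣⇒≤ p∣ , pr
    where instance _ = >-nonZero (subst (0 <_) (+-comm 1 (m !)) (s≤s z≤n))
  ...   | no  m≮p = contradiction (subst Prime p≡1 pr) ¬prime[1]
    where
    instance _ = prime⇒nonZero pr
    p≡1 : p ≡ 1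
    p≡1 = ∣1⇒≡1 (∣m+n∣m⇒∣n p∣ (∣-trans (n∣n! p) (m≤n⇒m!∣n! (≮⇒≥ m≮p))))

  search : ∀ m d j → m ≤ j → (∀ k → m < k → k ≤ j → ¬ Prime k) →
           (∃[ p ] j < p × p ≤ d + j × Prime p) → ∃[ p ] NextPrime m p
  search m zero    j m≤j none (p , j<p , p≤j , _) = contradiction j<p (≤⇒≯ p≤j)
  search m (suc d) j m≤j none ∃p with prime? (suc j)
  ... | yes pj = suc j , s≤s m≤j , pj , λ k m<k k<j → none k m<k (s≤s⁻¹ k<j)
  ... | no ¬pj = search m d (suc j) (m≤n⇒m≤1+n m≤j) none′ (later ∃p)
    where
    none′ : ∀ k → m < k → k ≤ suc j → ¬ Prime k
    none′ k m<k k≤ with m≤n⇒m<n∨m≡n k≤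
    ... | inj₁ k<   = none k m<k (s≤s⁻¹ k<)
    ... | inj₂ refl = ¬pj

    later : (∃[ p ] j < p × p ≤ suc (d + j) × Prime p) →
            ∃[ p ] suc j < p × p ≤ d + suc j × Prime p
    later (p , j<p , p≤ , pr) with m≤n⇒m<n∨m≡n j<p
    ... | inj₁ 1+j<p = p , 1+j<p , subst (p ≤_) (sym (+-suc d j)) p≤ , pr
    ... | inj₂ refl  = contradiction pr ¬pj

nextPrime : ∀ m → ∃[ p ] NextPrime m p
nextPrime m = search m (m ! + 1) m ≤-refl (λ k m<k k≤m → contradiction k≤m (<⇒≱ m<k)) bounded
  where
  bounded : ∃[ p ] m < p × p ≤ m ! + 1 + m × Prime p
  bounded with euclid m
  ... | p , m<p , p≤ , pr = p , m<p , ≤-trans p≤ (m≤m+n (m ! + 1) m) , pr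

prime : ℕ → ℕ
prime zero    = 2
prime (suc i) = proj₁ (nextPrime (prime i))

prime-isPrime : ∀ i → Prime (prime i)
prime-isPrime zero    = prime[2]
prime-isPrime (suc i) = proj₁ (proj₂ (proj₂ (nextPrime (prime i))))

codeFrom : ℕ → List ℕ → ℕ
codeFrom i []       = 1
codeFrom i (u ∷ us) = prime i ^ suc u * codeFrom (suc i) us

⟨_⟩ : List ℕ → ℕ
⟨_⟩ = codeFrom 0

private
  codeFrom>0 : ∀ i us → 0 < codeFrom i us
  codeFrom>0 i []       = s≤s z≤n
  codeFrom>0 i (u ∷ us) = *-mono-≤ (m^n>0 (prime i) (suc u)) (codeFrom>0 (suc i) us)
    where instance _ = prime⇒nonZero (prime-isPrime i)

  n<2^n : ∀ n → n < 2 ^ n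
  n<2^n zero    = s≤s z≤n
  n<2^n (suc n) = +-mono-≤ (m^n>0 2 n) (≤-trans (n<2^n n) (m≤m+n (2 ^ n) 0))

  2≤prime : ∀ i → 2 ≤ prime i
  2≤prime i = nonTrivial⇒n>1 _ {{prime⇒nonTrivial (prime-isPrime i)}}

  n<prime^n : ∀ i n → n < prime i ^ n
  n<prime^n i n = <-≤-trans (n<2^n n) (^-monoˡ-≤ n (2≤prime i))

  codeFrom? : ∀ s → Acc _<_ s → ∀ i → Dec (∃[ us ] codeFrom i us ≡ s)
  codeFrom? zero _ i = no λ (us , eq) → <⇒≢ (codeFrom>0 i us) (sym eq)
  codeFrom? s@(suc _) (acc rs) i with s ≟ 1
  ... | yes refl = yes ([] , refl)
  ... | no  s≢1  = map′ to from (anyUpTo? P? s)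
    where
    P : ℕ → Set
    P u = ∃[ us ] codeFrom i (u ∷ us) ≡ s

    P? : ∀ u → Dec (P u)
    P? u with (prime i ^ suc u) ∣? s
    ... | no  ∤s = no λ (us , eq) →
      ∤s (subst (prime i ^ suc u ∣_) eq (m∣m*n (codeFrom (suc i) us)))
    ... | yes (divides t s≡t*b) = map′
      (λ (us , eq) → us , trans (*-comm b _) (trans (cong (_* b) eq) (sym s≡t*b)))
      (λ (us , eq) → us , *-cancelʳ-≡ _ t b (trans (*-comm _ b) (trans eq s≡t*b)))
      (codeFrom? t (rs t<s) (suc i))
      where
      b : ℕ
      b = prime i ^ suc u
      1<b : 1 < b
      1<b = ≤-<-trans (s≤s z≤n) (n<prime^n i (suc u))
      instance
        b≢0 : NonZero b
        b≢0 = >-nonZero (<-trans (s≤s z≤n) 1<b)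
        t≢0 : NonZero t
        t≢0 = ≢-nonZero λ { refl → 1+n≢0 s≡t*b }
      t<s : t < s
      t<s = subst (t <_) (sym s≡t*b) (m<m*n t b 1<b)

    to : (∃[ u ] u < s × P u) → ∃[ us ] codeFrom i us ≡ s
    to (u , _ , us , eq) = u ∷ us , eq

    from : (∃[ us ] codeFrom i us ≡ s) → ∃[ u ] u < s × P u
    from ([]     , eq) = contradiction (sym eq) s≢1
    from (u ∷ us , eq) = u , u<s , us , eq
      where
      instance _ = >-nonZero (codeFrom>0 (suc i) us)
      u<s : u < s
      u<s = subst (u <_) eq
        (<-≤-trans (<-trans (n<1+n u) (n<prime^n i (suc u))) (m≤m*n (prime i ^ suc u) _))

isCode? : ∀ s → Dec (∃[ us ] ⟨ us ⟩ ≡ s)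
isCode? s = codeFrom? s (<-wellFounded s) 0

-- Out-of-range indices give 0.
lookup₀ : List ℕ → ℕ → ℕ
lookup₀ []       i       = 0
lookup₀ (u ∷ us) zero    = u
lookup₀ (u ∷ us) (suc i) = lookup₀ us i

-- entry s i is (s)ᵢ.
entry : ℕ → ℕ → ℕ
entry s i with isCode? s
... | yes (us , _) = lookup₀ us i
... | no  _        = 0

q : ℕ → ℚ
q k = + entry k 0 ℚ./ suc (entry k 1)

-- 𝒩, 𝒩 × 𝒩, (𝒩 × 𝒩) × 𝒩, …: all the Polish spaces that the unfolding of
-- G^𝒩ₙ involves.
data Space : Set where
  𝓝   : Space
  _×𝓝 : Space → Space

⟦_⟧ : Space → Set
⟦ 𝓝 ⟧    = ℕ → ℕ
⟦ X ×𝓝 ⟧ = ⟦ X ⟧ × (ℕ → ℕ)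

-- Equality of points.  Function extensionality is not available, so it
-- is pointwise.  Open sets, and hence projective sets, respect it.
_≈_ : ∀ {X} → ⟦ X ⟧ → ⟦ X ⟧ → Set
_≈_ {𝓝}    α       β       = ∀ i → α i ≡ β i
_≈_ {X ×𝓝} (x , α) (y , β) = _≈_ {X} x y × (∀ i → α i ≡ β i)

-- All coordinates of x and y agree below m: for fixed x this is a basic
-- neighbourhood of x in the product topology.
Agree : ∀ X → ℕ → ⟦ X ⟧ → ⟦ X ⟧ → Set
Agree 𝓝      m α       β       = ∀ i → i < m → α i ≡ β i
Agree (X ×𝓝) m (x , α) (y , β) = Agree X m x y × Agree 𝓝 m α β

IsOpen : ∀ X → Pred ⟦ X ⟧ 0ℓ → Set
IsOpen X V = ∀ x → x ∈ V → ∃[ m ] (∀ y → Agree X m x y → y ∈ V)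

IsClosed : ∀ X → Pred ⟦ X ⟧ 0ℓ → Set
IsClosed X C = IsOpen X (∁ C)

-- A non-negative real, given by the upper Dedekind cut of the rationals
-- strictly above it.
record ℝ≥0 : Set₁ where
  field
    Above    : ℚ → Set
    bounded  : ∃[ a ] Above a
    positive : ∀ {a} → Above a → 0ℚ ℚ.< a
    upward   : ∀ {a b} → Above a → a ℚ.< b → Above b
    rounded  : ∀ {b} → Above b → ∃[ a ] a ℚ.< b × Above a

_<ᴿ_ : ℝ≥0 → ℚ → Set
_<ᴿ_ = ℝ≥0.Above

_≃_ : ℝ≥0 → ℝ≥0 → Set
r ≃ s = ∀ a → (r <ᴿ a) ⇔ (s <ᴿ a)

_≃ℚ_ : ℝ≥0 → ℚ → Set
r ≃ℚ a = ∀ b → (r <ᴿ b) ⇔ (a ℚ.< b)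

record Metric (X : Space) : Set₁ where
  field
    dist       : ⟦ X ⟧ → ⟦ X ⟧ → ℝ≥0
    separation : ∀ x y → (dist x y ≃ℚ 0ℚ) ⇔ _≈_ {X} x y
    symmetry   : ∀ x y → dist x y ≃ dist y x
    -- d(x,z) ≤ d(x,y) + d(y,z)
    triangle   : ∀ x y z a b → dist x y <ᴿ a → dist y z <ᴿ b → dist x z <ᴿ (a ℚ.+ b)

  ball : ⟦ X ⟧ → ℚ → Pred ⟦ X ⟧ 0ℓ
  ball x a y = dist x y <ᴿ a

  MetricOpen : Pred ⟦ X ⟧ 0ℓ → Set
  MetricOpen V = ∀ x → x ∈ V → ∃[ a ] 0ℚ ℚ.< a × ball x a ⊆ V

record Presentation (X : Space) : Set₁ where
  field
    metric     : Metric X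
    compatible : ∀ (V : Pred ⟦ X ⟧ 0ℓ) → Metric.MetricOpen metric V ⇔ IsOpen X V
    centre     : ℕ → ⟦ X ⟧
    dense      : ∀ (V : Pred ⟦ X ⟧ 0ℓ) → IsOpen X V → ∃ V → ∃[ i ] centre i ∈ V

  open Metric metric public

-- The choice of a compatible metric and a dense sequence on every space.
-- It is arbitrary except on 𝒩, where d(α,β) = 1/(n+1) for the least n
-- with α(n) ≠ β(n), and r_s(i) = (s)ᵢ.
record Presentations : Set₁ where
  field
    presentation : ∀ X → Presentation X

  private module Baire = Presentation (presentation 𝓝)
  field
    𝓝-dist   : ∀ α β n → (∀ i → i < n → α i ≡ β i) → α n ≢ β n →
               Baire.dist α β ≃ℚ (+ 1 ℚ./ suc n)
    𝓝-centre : ∀ s i → Baire.centre s i ≡ entry s i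

module Universal (𝒫 : Presentations) where
  open Presentations 𝒫

  N : ∀ X → ℕ → Pred ⟦ X ⟧ 0ℓ
  N X s = ball (centre (entry s 0)) (q (entry s 1))
    where open Presentation (presentation X)

  U : ∀ X → ⟦ 𝓝 ⟧ → Pred ⟦ X ⟧ 0ℓ
  U X α x = ∃[ n ] x ∈ N X (α n)

  F : ∀ X → ⟦ 𝓝 ⟧ → Pred ⟦ X ⟧ 0ℓ
  F X α = ∁ (U X α)

  G : ∀ X n → {{NonZero n}} → ⟦ 𝓝 ⟧ → Pred ⟦ X ⟧ 0ℓ
  G X 1             α x = ∃[ γ ] F (X ×𝓝) α (x , γ)
  G X (suc (suc n)) α x = ∃[ γ ] ¬ G (X ×𝓝) (suc n) α (x , γ)

mutual
  Σ¹ : ∀ X n → {{NonZero n}} → Pred ⟦ X ⟧ 0ℓ → Set₁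
  Σ¹ X 1 A =
    Σ[ C ∈ Pred ⟦ X ×𝓝 ⟧ 0ℓ ] IsClosed (X ×𝓝) C × A ≐ (λ x → ∃[ γ ] (x , γ) ∈ C)
  Σ¹ X (suc (suc n)) A =
    Σ[ B ∈ Pred ⟦ X ×𝓝 ⟧ 0ℓ ] Π¹ (X ×𝓝) (suc n) B × A ≐ (λ x → ∃[ γ ] (x , γ) ∈ B)

  Π¹ : ∀ X n → {{NonZero n}} → Pred ⟦ X ⟧ 0ℓ → Set₁
  Π¹ X n A = Σ¹ X n (∁ A)

Δ¹ : ∀ X n → {{NonZero n}} → Pred ⟦ X ⟧ 0ℓ → Set₁
Δ¹ X n A = Σ¹ X n A × Π¹ X n A

Δ¹-Measurable : ∀ n → {{NonZero n}} → (⟦ 𝓝 ⟧ → ⟦ 𝓝 ⟧) → Set₁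
Δ¹-Measurable n f = ∀ (V : Pred ⟦ 𝓝 ⟧ 0ℓ) → IsOpen 𝓝 V → Δ¹ 𝓝 n (f ⊢ V)

closure : ∀ X → Pred ⟦ X ⟧ 0ℓ → Pred ⟦ X ⟧ (lsuc 0ℓ)
closure X A x = ∀ (V : Pred ⟦ X ⟧ 0ℓ) → IsOpen X V → x ∈ V → ∃[ y ] y ∈ V × y ∈ A

NowhereDense : ∀ X → Pred ⟦ X ⟧ 0ℓ → Set₁
NowhereDense X A = ∀ (V : Pred ⟦ X ⟧ 0ℓ) → IsOpen X V → V ⊆ closure X A → Empty V

Meager : ∀ X → Pred ⟦ X ⟧ 0ℓ → Set₁
Meager X A = Σ[ D ∈ (ℕ → Pred ⟦ X ⟧ 0ℓ) ] (∀ k → NowhereDense X (D k)) × A ≐ ⋃ ℕ D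

_△_ : ∀ {ℓ} {A : Set ℓ} → Pred A 0ℓ → Pred A 0ℓ → Pred A 0ℓ
P △ Q = (P ∖ Q) ∪ (Q ∖ P)

{-# OPTIONS --safe #-}
module Submission where

-- By a recursion theorem, every Σ¹ₙ set A ⊆ 𝒩 admits an α such that G^𝒩ₙ(α)
-- is all of 𝒩 if α ∈ A, and empty otherwise.  For A = {α : U^𝒩(f(α)) = ∅},
-- the symmetric difference of G^𝒩ₙ(α) and U^𝒩(f(α)) then contains a nonempty
-- open set, so it is non-meager by the Baire category theorem.
--
-- Both G^𝒩ₙ and the Σ¹ₙ sets put the same quantifiers in front of a closed
-- matrix, so the recursion theorem is only needed for open sets O.  There
-- α(k) can be chosen by recursion on k: it is the code of a ball that the
-- values α(0), …, α(k-1) already force into the section of O at α.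

open import Defs
open import Axiom.ExcludedMiddle using (ExcludedMiddle)
open import Data.Empty using (⊥-elim)
open import Data.Integer.Base using (+_; -[1+_])
open import Data.List.Base using (List; []; _∷_)
open import Data.Nat.Base
open import Data.Nat.Divisibility using (_∣_; ∣1⇒≡1; m∣m*n)
open import Data.Nat.Primality using (Prime; ¬prime[1]; euclidsLemma; prime⇒nonZero; prime⇒nonTrivial; prime⇒irreducible)
open import Data.Nat.Properties
open import Data.Product.Base using (∃; ∃-syntax; _×_; _,_; proj₁; proj₂)
open import Data.Rational.Base as ℚ using (ℚ; 0ℚ; ½)
import Data.Rational.Properties as ℚ
open import Data.Sum.Base using (inj₁; inj₂)
open import Data.Unit.Base using (⊤)
open import Function.Bundles using (_⇔_; mk⇔; Equivalence)
open import Level using (0ℓ; lift; lower) renaming (suc to lsuc)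
open import Relation.Binary.PropositionalEquality
open import Relation.Nullary using (¬_; Dec; yes; no; contradiction)
open import Relation.Nullary.Decidable using (map′; decidable-stable)
open import Relation.Unary using (Pred; _∈_; _∉_; _⊆_)

open Equivalence using (to; from)

-- Unique decoding of prime-power sequence codes.

prime-∣-prime : ∀ {p r} → Prime p → Prime r → p ∣ r → p ≡ r
prime-∣-prime p-pr r-pr p∣r with prime⇒irreducible r-pr p∣r
... | inj₁ refl = contradiction p-pr ¬prime[1]
... | inj₂ p≡r  = p≡r

prime-∣-^ : ∀ {p} r n → Prime p → p ∣ r ^ n → p ∣ r
prime-∣-^ r zero    p-pr p∣1 = contradiction (subst Prime (∣1⇒≡1 p∣1) p-pr) ¬prime[1]
prime-∣-^ r (suc n) p-pr p∣  with euclidsLemma r (r ^ n) p-pr p∣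
... | inj₁ p∣r  = p∣r
... | inj₂ p∣rⁿ = prime-∣-^ r n p-pr p∣rⁿ

-- The factors are powers of `prime j` with `j ≥ i`, and these primes increase. So `prime i` cannot
-- divide the tail of a code, and its exponent recovers the head.
prime-∣-codeFrom : ∀ {p} i us → Prime p → p ∣ codeFrom i us → prime i ≤ p
prime-∣-codeFrom i []       p-pr p∣ = contradiction (subst Prime (∣1⇒≡1 p∣) p-pr) ¬prime[1]
prime-∣-codeFrom i (u ∷ us) p-pr p∣ with euclidsLemma (prime i ^ suc u) (codeFrom (suc i) us) p-pr p∣
... | inj₁ p∣^ = ≤-reflexive (sym (prime-∣-prime p-pr (prime-isPrime i) (prime-∣-^ (prime i) (suc u) p-pr p∣^)))
... | inj₂ p∣c = ≤-trans (<⇒≤ (proj₁ (proj₂ (nextPrime (prime i))))) (prime-∣-codeFrom (suc i) us p-pr p∣c)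

prime-∤-codeFrom-suc : ∀ i us → ¬ prime i ∣ codeFrom (suc i) us
prime-∤-codeFrom-suc i us p∣ =
  <⇒≱ (proj₁ (proj₂ (nextPrime (prime i)))) (prime-∣-codeFrom (suc i) us (prime-isPrime i) p∣)

^*-injective : ∀ p .{{_ : NonZero p}} m n {a b} → ¬ p ∣ a → ¬ p ∣ b →
               p ^ m * a ≡ p ^ n * b → m ≡ n × a ≡ b
^*-injective p zero    zero    p∤a p∤b eq = refl , *-cancelˡ-≡ _ _ 1 eq
^*-injective p zero    (suc n) {a} {b} p∤a p∤b eq = contradiction
  (subst (p ∣_) (trans (sym (*-assoc p (p ^ n) b)) (trans (sym eq) (*-identityˡ a))) (m∣m*n (p ^ n * b))) p∤a
^*-injective p (suc m) zero    {a} {b} p∤a p∤b eq = contradiction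
  (subst (p ∣_) (trans (sym (*-assoc p (p ^ m) a)) (trans eq (*-identityˡ b))) (m∣m*n (p ^ m * a))) p∤b
^*-injective p (suc m) (suc n) {a} {b} p∤a p∤b eq
  with ^*-injective p m n p∤a p∤b
         (*-cancelˡ-≡ _ _ p (trans (sym (*-assoc p (p ^ m) a)) (trans eq (*-assoc p (p ^ n) b))))
... | refl , a≡b = refl , a≡b

codeFrom-∷≢1 : ∀ i u us → codeFrom i (u ∷ us) ≢ 1
codeFrom-∷≢1 i u us eq = contradiction (subst Prime (m*n≡1⇒m≡1 (prime i) _ p*≡1) (prime-isPrime i)) ¬prime[1]
  where
  p*≡1 : prime i * (prime i ^ u * codeFrom (suc i) us) ≡ 1
  p*≡1 = trans (sym (*-assoc (prime i) (prime i ^ u) _)) eq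

codeFrom-injective : ∀ i us vs → codeFrom i us ≡ codeFrom i vs → us ≡ vs
codeFrom-injective i []       []       eq = refl
codeFrom-injective i []       (v ∷ vs) eq = contradiction (sym eq) (codeFrom-∷≢1 i v vs)
codeFrom-injective i (u ∷ us) []       eq = contradiction eq (codeFrom-∷≢1 i u us)
codeFrom-injective i (u ∷ us) (v ∷ vs) eq
  with ^*-injective (prime i) {{prime⇒nonZero (prime-isPrime i)}} (suc u) (suc v)
         (prime-∤-codeFrom-suc i us) (prime-∤-codeFrom-suc i vs) eq
... | refl , eq′ = cong (u ∷_) (codeFrom-injective (suc i) us vs eq′)

entry-⟨⟩ : ∀ us i → entry ⟨ us ⟩ i ≡ lookup₀ us i
entry-⟨⟩ us i with isCode? ⟨ us ⟩
... | yes (vs , eq) = cong (λ ws → lookup₀ ws i) (codeFrom-injective 0 vs us eq)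
... | no  ¬code     = contradiction (us , refl) ¬code

n<prime^n : ∀ i n → n < prime i ^ n
n<prime^n i zero    = s≤s z≤n
n<prime^n i (suc n) = begin-strict
  suc n                 ≤⟨ n<prime^n i n ⟩
  prime i ^ n           <⟨ m<m*n (prime i ^ n) (prime i) (nonTrivial⇒n>1 (prime i)) ⟩
  prime i ^ n * prime i ≡⟨ *-comm (prime i ^ n) (prime i) ⟩
  prime i ^ suc n       ∎
  where
  open ≤-Reasoning
  instance
    _ = prime⇒nonTrivial (prime-isPrime i)
    _ = prime⇒nonZero (prime-isPrime i)
    _ = m^n≢0 (prime i) n

codeFrom-nonZero : ∀ i us → NonZero (codeFrom i us)
codeFrom-nonZero i []       = _
codeFrom-nonZero i (u ∷ us) = m*n≢0 _ _ {{m^n≢0 (prime i) (suc u)}} {{codeFrom-nonZero (suc i) us}}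
  where instance _ = prime⇒nonZero (prime-isPrime i)

head<codeFrom : ∀ i u us → u < codeFrom i (u ∷ us)
head<codeFrom i u us = <-≤-trans (<-trans (n<1+n u) (n<prime^n i (suc u))) (m≤m*n _ (codeFrom (suc i) us))
  where instance _ = codeFrom-nonZero (suc i) us

tail≤codeFrom : ∀ i u us → codeFrom (suc i) us ≤ codeFrom i (u ∷ us)
tail≤codeFrom i u us = m≤n*m (codeFrom (suc i) us) (prime i ^ suc u)
  where
  instance
    _ = prime⇒nonZero (prime-isPrime i)
    _ = m^n≢0 (prime i) (suc u)

-- Abstract because the type checker would otherwise evaluate the primes.
abstract
  pair : ∀ u v → ∃[ s ] entry s 0 ≡ u × entry s 1 ≡ v × v ≤ s
  pair u v = ⟨ us ⟩ , entry-⟨⟩ us 0 , entry-⟨⟩ us 1 ,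
    ≤-trans (<⇒≤ (head<codeFrom 1 v [])) (tail≤codeFrom 0 u (v ∷ []))
    where
    us : List ℕ
    us = u ∷ v ∷ []

-- `mkℚ` stores the denominator minus one, which is how `q` reads the second entry.
q-surjective : ∀ a → 0ℚ ℚ.< a → ∃[ k ] q k ≡ a
q-surjective (ℚ.mkℚ -[1+ _ ] _ _)   (ℚ.*<* ())
q-surjective (ℚ.mkℚ (+ n) d coprime) _ with pair n d
... | k , k₀≡n , k₁≡d , _ =
  k , trans (cong₂ (λ u v → + u ℚ./ suc v) k₀≡n k₁≡d) (ℚ.↥p/↧p≡p (ℚ.mkℚ (+ n) d coprime))

½+½ : ∀ a → ½ ℚ.* a ℚ.+ ½ ℚ.* a ≡ a
½+½ a = trans (sym (ℚ.*-distribʳ-+ a ½ ½)) (ℚ.*-identityˡ a)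

0<½* : ∀ {a} → 0ℚ ℚ.< a → 0ℚ ℚ.< ½ ℚ.* a
0<½* {a} 0<a = subst (ℚ._< ½ ℚ.* a) (ℚ.*-zeroʳ ½) (ℚ.*-monoʳ-<-pos ½ 0<a)

-- Agreement neighbourhoods and change of the base coordinate.

≈-refl : ∀ X (x : ⟦ X ⟧) → _≈_ {X} x x
≈-refl 𝓝       x       = λ _ → refl
≈-refl (X ×𝓝) (x , _) = ≈-refl X x , λ _ → refl

Agree-refl : ∀ X {m} (x : ⟦ X ⟧) → Agree X m x x
Agree-refl 𝓝      x       = λ _ _ → refl
Agree-refl (X ×𝓝) (x , _) = Agree-refl X x , λ _ _ → refl

Agree-trans : ∀ X {m} {x y z : ⟦ X ⟧} → Agree X m x y → Agree X m y z → Agree X m x z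
Agree-trans 𝓝      p       r       = λ i i<m → trans (p i i<m) (r i i<m)
Agree-trans (X ×𝓝) (p , s) (r , t) = Agree-trans X p r , λ i i<m → trans (s i i<m) (t i i<m)

Agree-open : ∀ X m (x : ⟦ X ⟧) → IsOpen X (Agree X m x)
Agree-open X m x y x~y = m , λ z y~z → Agree-trans X x~y y~z

Agree-mono : ∀ {k m} {α β : ⟦ 𝓝 ⟧} → k ≤ m → Agree 𝓝 m α β → Agree 𝓝 k α β
Agree-mono k≤m α~β i i<k = α~β i (<-≤-trans i<k k≤m)

-- Feeds the parameter into a set while keeping the quantified coordinates. On `𝓝` the point is
-- forgotten, so a condition on `rebase 𝓝 α x` holds for all `x` or for none.
rebase : ∀ X → ⟦ 𝓝 ⟧ → ⟦ X ⟧ → ⟦ X ⟧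
rebase 𝓝      α _       = α
rebase (X ×𝓝) α (x , γ) = rebase X α x , γ

rebase-agree : ∀ X {m α β} {x y : ⟦ X ⟧} → Agree 𝓝 m α β → Agree X m x y →
               Agree X m (rebase X α x) (rebase X β y)
rebase-agree 𝓝      α~β x~y         = α~β
rebase-agree (X ×𝓝) α~β (x~y , γ~δ) = rebase-agree X α~β x~y , γ~δ

-- Balls as a base of the topology.

module _ {X} (P : Presentation X) where
  open Presentation P

  ball-metricOpen : ∀ x a → MetricOpen (ball x a)
  ball-metricOpen x a y y∈ with ℝ≥0.rounded (dist x y) y∈
  -- Roundedness of the cut leaves a gap between `b` and `a`, which serves as the radius around `y`.
  ... | b , b<a , y∈b = a ℚ.- b , 0<a-b , λ {z} z∈ → subst (dist x z <ᴿ_) b+[a-b] (triangle x y z b (a ℚ.- b) y∈b z∈)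
    where
    0<a-b : 0ℚ ℚ.< a ℚ.- b
    0<a-b = subst (ℚ._< a ℚ.- b) (ℚ.+-inverseʳ b) (ℚ.+-monoˡ-< (ℚ.- b) b<a)
    b+[a-b] : b ℚ.+ (a ℚ.- b) ≡ a
    b+[a-b] = trans (ℚ.+-comm b (a ℚ.- b))
      (trans (ℚ.+-assoc a (ℚ.- b) b) (trans (cong (a ℚ.+_) (ℚ.+-inverseˡ b)) (ℚ.+-identityʳ a)))

  ball-open : ∀ x a → IsOpen X (ball x a)
  ball-open x a = to (compatible _) (ball-metricOpen x a)

  ∈-ball : ∀ x {a} → 0ℚ ℚ.< a → x ∈ ball x a
  ∈-ball x 0<a = from (from (separation x x) (≈-refl X x) _) 0<a

  -- With a dense point at distance below `½ * a` from `x`, the ball of that radius around it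
  -- contains `x` by symmetry and stays in `ball x a` by the triangle inequality.
  ball-base : ∀ {V} → IsOpen X V → ∀ x → x ∈ V →
              ∃[ i ] ∃[ b ] 0ℚ ℚ.< b × x ∈ ball (centre i) b × ball (centre i) b ⊆ V
  ball-base V-open x x∈V with from (compatible _) V-open x x∈V
  ... | a , 0<a , ball⊆V with dense (ball x (½ ℚ.* a)) (ball-open x _) (x , ∈-ball x (0<½* 0<a))
  ... | i , xi = i , ½ ℚ.* a , 0<½* 0<a , to (symmetry x (centre i) _) xi ,
    λ {z} z∈ → ball⊆V (subst (dist x z <ᴿ_) (½+½ a) (triangle x (centre i) z _ _ xi z∈))

module Classical (em : ExcludedMiddle (lsuc 0ℓ)) where

  em₀ : ExcludedMiddle 0ℓ
  em₀ = map′ lower lift em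

  dne : ∀ {A : Set} → ¬ ¬ A → A
  dne = decidable-stable em₀

  -- The Baire category theorem.

  -- Otherwise every open set meeting the neighbourhood of `x` would meet `D`, and the neighbourhood
  -- would lie in the closure of `D`.
  nowhereDense-avoid : ∀ {D} → NowhereDense 𝓝 D → ∀ x m →
    ∃[ y ] ∃[ m′ ] m < m′ × Agree 𝓝 m x y × (∀ z → Agree 𝓝 m′ y z → z ∉ D)
  nowhereDense-avoid {D} nd x m = dne λ none →
    nd (Agree 𝓝 m x) (Agree-open 𝓝 m x)
      (λ {y} x~y V V-open y∈V → dne λ ¬meet → none (let (m₀ , sub) = V-open y y∈V in
        y , suc (m ⊔ m₀) , s≤s (m≤m⊔n m m₀) , x~y ,
        λ z y~z z∈D → ¬meet (z , sub z (Agree-mono (m≤n⇒m≤1+n (m≤n⊔m m m₀)) y~z) , z∈D)))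
      x (Agree-refl 𝓝 x)

  baire : ∀ {V A} → IsOpen 𝓝 V → ∃ V → V ⊆ A → ¬ Meager 𝓝 A
  baire {V} {A} V-open (x₀ , x₀∈V) V⊆A (D , nd , A⊆ , _) =
    let (k , x∈D) = A⊆ (V⊆A limit∈V) in avoids k x∈D
    where
    m₀ = proj₁ (V-open x₀ x₀∈V)

    stage : ℕ → ⟦ 𝓝 ⟧ × ℕ
    stage zero    = x₀ , m₀
    stage (suc k) = let (x , m) = stage k ; (y , m′ , _) = nowhereDense-avoid (nd k) x m in y , m′

    pt : ℕ → ⟦ 𝓝 ⟧
    pt k = proj₁ (stage k)

    len : ℕ → ℕ
    len k = proj₂ (stage k)

    step : ∀ k → len k < len (suc k) × Agree 𝓝 (len k) (pt k) (pt (suc k)) ×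
                 (∀ z → Agree 𝓝 (len (suc k)) (pt (suc k)) z → z ∉ D k)
    step k = proj₂ (proj₂ (nowhereDense-avoid (nd k) (pt k) (len k)))

    k≤len : ∀ k → k ≤ len k
    k≤len zero    = z≤n
    k≤len (suc k) = ≤-<-trans (k≤len k) (proj₁ (step k))

    pt-agree : ∀ {k l} → k ≤′ l → len k ≤ len l × Agree 𝓝 (len k) (pt k) (pt l)
    pt-agree (≤′-reflexive refl) = ≤-refl , λ _ _ → refl
    pt-agree {l = suc l} (≤′-step k≤l) with pt-agree k≤l
    ... | le , ag = ≤-trans le (<⇒≤ (proj₁ (step l))) ,
                    Agree-trans 𝓝 ag (Agree-mono le (proj₁ (proj₂ (step l))))

    limit : ⟦ 𝓝 ⟧
    -- Coordinate `i` is final from stage `suc i` on, because `len (suc i)` exceeds `i`.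
    limit i = pt (suc i) i

    limit-agree : ∀ k → Agree 𝓝 (len k) (pt k) limit
    limit-agree k i i<len with ≤-total k (suc i)
    ... | inj₁ k≤ = proj₂ (pt-agree (≤⇒≤′ k≤)) i i<len
    ... | inj₂ ≤k = sym (proj₂ (pt-agree (≤⇒≤′ ≤k)) i (k≤len (suc i)))

    limit∈V : limit ∈ V
    limit∈V = proj₂ (V-open x₀ x₀∈V) limit (limit-agree 0)

    avoids : ∀ k → limit ∉ D k
    avoids k = proj₂ (proj₂ (step k)) limit (limit-agree (suc k))

  -- φ receives the earlier values padded with zeros, so the recursion is only
  -- meaningful if φ k β depends on β below k.
  module CourseOfValues (φ : ℕ → ⟦ 𝓝 ⟧ → ℕ) where

    approx : ℕ → ⟦ 𝓝 ⟧
    approx zero    i = 0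
    approx (suc k) i with i ≟ k
    ... | yes _ = φ k (approx k)
    ... | no  _ = approx k i

    fix : ⟦ 𝓝 ⟧
    fix k = φ k (approx k)

    approx-agree : ∀ k → Agree 𝓝 k (approx k) fix
    approx-agree (suc k) i i<1+k with i ≟ k
    ... | yes refl = refl
    ... | no  i≢k  = approx-agree k i (≤∧≢⇒< (s≤s⁻¹ i<1+k) i≢k)

  -- Coded basic open sets and the recursion theorem.

  module _ (𝒫 : Presentations) where
    open Presentations 𝒫
    open Universal 𝒫

    N-open : ∀ X s → IsOpen X (N X s)
    N-open X s = ball-open (presentation X) _ _

    -- The number 0 codes no sequence, so its entries default to 0 and the radius is `q 0`, that is,
    -- 0. This makes 0 a code for "add nothing".
    N-0-empty : ∀ X {x} → x ∉ N X 0
    N-0-empty X x∈ = ℚ.<-irrefl refl (ℝ≥0.positive (dist _ _) x∈)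
      where open Presentation (presentation X)

    ball-is-N : ∀ X i a → 0ℚ ℚ.< a →
                ∃[ s ] N X s ≡ Presentation.ball (presentation X) (Presentation.centre (presentation X) i) a
    ball-is-N X i a 0<a =
      let (k , qk≡a) = q-surjective a 0<a
          (s , s₀≡i , s₁≡k , _) = pair i k
      in s , cong₂ (λ j b → ball (centre j) b) s₀≡i (trans (cong q s₁≡k) qk≡a)
      where open Presentation (presentation X)

    N-base : ∀ X {V} → IsOpen X V → ∀ x → x ∈ V → ∃[ s ] x ∈ N X s × N X s ⊆ V
    N-base X {V} V-open x x∈V =
      let (i , b , 0<b , x∈ball , ball⊆V) = ball-base (presentation X) V-open x x∈V
          (s , N≡ball) = ball-is-N X i b 0<b
      in s , subst (x ∈_) (sym N≡ball) x∈ball , λ {z} z∈ → ball⊆V (subst (z ∈_) N≡ball z∈)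

    U-open : ∀ X α → IsOpen X (U X α)
    U-open X α x (n , x∈) =
      let (m , sub) = N-open X (α n) x x∈ in m , λ y x~y → n , sub y x~y

    -- A single nonempty ball `N 𝓝 (α n)` witnesses it, and only `α n` is involved.
    nonemptyU-open : IsOpen 𝓝 (λ α → ∃ (U 𝓝 α))
    nonemptyU-open α (x , n , x∈) =
      suc n , λ β α~β → x , n , subst (λ s → x ∈ N 𝓝 s) (α~β n ≤-refl) x∈

    U-recursion : ∀ X {O} → IsOpen X O → ∃[ α ] ∀ z → U X α z ⇔ (rebase X α z ∈ O)
    U-recursion X {O} O-open = fix , λ z → mk⇔ (λ (k , z∈) → sound k z z∈) (complete z)
      where
      Forced : ℕ → ⟦ 𝓝 ⟧ → Set
      -- Quantifying over all extensions of the first `k` values avoids any reference to the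
      -- sequence under construction.
      Forced k β = ∀ α → Agree 𝓝 k β α → ∀ z → z ∈ N X (entry k 0) → rebase X α z ∈ O

      -- The decision is an argument so that proofs can split on it.
      choose : ∀ k β → Dec (Forced k β) → ℕ
      choose k β (yes _) = entry k 0
      choose k β (no  _) = 0

      open CourseOfValues (λ k β → choose k β em₀)

      choose-sound : ∀ k β (d : Dec (Forced k β)) α z → Agree 𝓝 k β α →
                     z ∈ N X (choose k β d) → rebase X α z ∈ O
      choose-sound k β (yes forced) α z β~α z∈ = forced α β~α z z∈
      choose-sound k β (no  _)      α z β~α z∈ = ⊥-elim (N-0-empty X z∈)

      choose-forced : ∀ k β (d : Dec (Forced k β)) → Forced k β → choose k β d ≡ entry k 0
      choose-forced k β (yes _)       forced = refl
      choose-forced k β (no  ¬forced) forced = contradiction forced ¬forced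

      sound : ∀ k z → z ∈ N X (fix k) → rebase X fix z ∈ O
      sound k z = choose-sound k (approx k) em₀ fix z (approx-agree k)

      complete : ∀ z → rebase X fix z ∈ O → U X fix z
      complete z z∈O =
        let (m , sub) = O-open _ z∈O
            (s , z∈s , s⊆) = N-base X (Agree-open X m z) z (Agree-refl X z)
            -- Each ball is proposed at arbitrarily late indices; `m ≤ k` ensures that the values
            -- below `k` already determine membership in `O`.
            (k , k₀≡s , _ , m≤k) = pair s m
            forced : Forced k (approx k)
            forced α ≈~α y y∈ = sub _ (rebase-agree X
              (Agree-mono m≤k λ i i<k → trans (sym (approx-agree k i i<k)) (≈~α i i<k))
              (s⊆ (subst (λ t → y ∈ N X t) k₀≡s y∈)))
            fix≡s = trans (choose-forced k (approx k) em₀ forced) k₀≡s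
        in k , subst (λ t → z ∈ N X t) (sym fix≡s) z∈s

    -- Each quantifier moves one coordinate into the space. As `rebase` keeps `γ`, the same witness
    -- serves both sides, and the equivalence for the complement of the matrix is negated.
    G-recursion : ∀ X n {{_ : NonZero n}} {A} → Σ¹ X n A →
                  ∃[ α ] ∀ z → G X n α z ⇔ (rebase X α z ∈ A)
    G-recursion X 1 (C , C-closed , A⊆ , ⊆A) =
      let (α , U⇔) = U-recursion (X ×𝓝) C-closed in α , λ z → mk⇔
        (λ (γ , ¬u) → ⊆A (γ , dne λ ∉C → ¬u (from (U⇔ (z , γ)) ∉C)))
        (λ z∈A → let (γ , ∈C) = A⊆ z∈A in γ , λ u → to (U⇔ (z , γ)) u ∈C)
    G-recursion X (suc (suc n)) (B , B-Π , A⊆ , ⊆A) =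
      let (α , G⇔) = G-recursion (X ×𝓝) (suc n) B-Π in α , λ z → mk⇔
        (λ (γ , ¬g) → ⊆A (γ , dne λ ∉B → ¬g (from (G⇔ (z , γ)) ∉B)))
        (λ z∈A → let (γ , ∈B) = A⊆ z∈A in γ , λ g → to (G⇔ (z , γ)) g ∈B)

theorem10 : ExcludedMiddle (lsuc 0ℓ) → (𝒫 : Presentations) → (n : ℕ) {{_ : NonZero n}} →
    (f : ⟦ 𝓝 ⟧ → ⟦ 𝓝 ⟧) → Δ¹-Measurable n f →
    ∃[ α ] ¬ Meager 𝓝 (Universal.G 𝒫 𝓝 n α △ Universal.U 𝒫 𝓝 (f α))
theorem10 em 𝒫 n f f-meas = α , nonMeager em₀
  where
  open Classical em
  open Universal 𝒫

  recursion : ∃[ α ] ∀ x → G 𝓝 n α x ⇔ (¬ ∃ (U 𝓝 (f α)))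
  -- The set used is the complement of a preimage of an open set, hence the Π half of measurability.
  recursion = G-recursion 𝒫 𝓝 n (proj₂ (f-meas _ (nonemptyU-open 𝒫)))

  α : ⟦ 𝓝 ⟧
  α = proj₁ recursion

  nonMeager : Dec (∃ (U 𝓝 (f α))) → ¬ Meager 𝓝 (G 𝓝 n α △ U 𝓝 (f α))
  -- Here `G 𝓝 n α` is empty, so the difference contains the nonempty open set `U 𝓝 (f α)`.
  nonMeager (yes nonempty) = baire (U-open 𝒫 𝓝 (f α)) nonempty
    (λ {x} u → inj₂ (u , λ g → to (proj₂ recursion x) g nonempty))
  -- Here `G 𝓝 n α` is everything and `U 𝓝 (f α)` is empty, so the difference is the whole space.
  nonMeager (no  empty)    = baire {V = λ _ → ⊤} (λ _ _ → 0 , _) (α , _)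
    (λ {x} _ → inj₁ (from (proj₂ recursion x) empty , λ u → empty (x , u)))
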